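{- Let $q\ge 1$ be an integer and let $a_q(n)$ be the number of arrangements of black and white beads on a necklace with a total of $n$ beads such that there is at least one black bead, between any two (cyclically consecutive) black beads the number of white beads is divisible by $q$, and rotations and flippings of a necklace are considered distinct. If $n$ is prime then $a_q(n)\equiv 1\pmod n$. In particular, the Lucas numbers satisfy $L_n\equiv 1\pmod n$ for every prime $n$.
   Context: A necklace on $n$ beads is a coloring, black or white, of the $n$ positions $1,2,\ldots,n$ arranged cyclically (position $n$ adjacent to position $1$). Since rotations and flippings are considered distinct, necklaces are counted as functions from the set of labelled positions to $\{\text{black},\text{white}\}$. The divisibility condition is read cyclically: for each black bead, the number of white beads strictly between it and the next black bead encountered clockwise must be divisible by $q$; if there is exactly one black bead, there are $n-1$ white beads between it and itself, so the condition requires $q\mid n-1$. The Lucas numbers are defined by $L_0=2$, $L_1=1$, and $L_n=L_{n-1}+L_{n-2}$ for $n\ge 2$. -}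

module Defs where

open import Data.Fin.Base using (Fin; toℕ)
open import Data.Fin.Properties using (all?; any?)
import Data.Integer.Base as ℤ
import Data.Integer.Divisibility as ℤ
open import Data.List.Base using (List; []; _∷_; _++_; map; filter; length)
open import Data.Nat.Base using (ℕ; zero; suc; _+_)
open import Data.Nat.Divisibility using (_∣_; _∣?_)
open import Data.Nat.DivMod using (_mod_)
open import Data.Product.Base using (∃; _×_)
open import Data.Vec.Base using (Vec; []; _∷_; lookup)
open import Relation.Binary.Definitions using (DecidableEquality)
open import Relation.Binary.PropositionalEquality using (_≡_; refl)
open import Relation.Nullary.Decidable using (Dec; yes; no; _×-dec_; _→-dec_)

data Color : Set where
  black white : Color

_≟_ : DecidableEquality Color
black ≟ black = yes refl
black ≟ white = no λ ()
white ≟ black = no λ ()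
white ≟ white = yes refl

-- Positions are labelled, so rotations and flips of a necklace are
-- different elements of this type.
Necklace : ℕ → Set
Necklace n = Vec Color n

-- i ↻ k is the position k steps clockwise from i.
infixl 6 _↻_
_↻_ : ∀ {n} → Fin n → ℕ → Fin n
_↻_ {suc m} i k = (toℕ i + k) mod suc m

-- The first black bead strictly clockwise of i comes after exactly k white
-- beads.  If i carries the only black bead, that next bead is i itself,
-- with k = n - 1.
Gap : ∀ {n} → Necklace n → Fin n → ℕ → Set
Gap c i k = (∀ (j : Fin k) → lookup c (i ↻ suc (toℕ j)) ≡ white)
          × lookup c (i ↻ suc k) ≡ black

-- Bounding k by n loses nothing: starting from a black bead, n steps
-- lead back to it, so at most n - 1 white beads can be passed.
Admissible : ℕ → ∀ {n} → Necklace n → Set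
Admissible q {n} c =
    (∃ λ (i : Fin n) → lookup c i ≡ black)
  × (∀ (i : Fin n) → lookup c i ≡ black →
     ∀ (k : Fin n) → Gap c i (toℕ k) → q ∣ toℕ k)

gap? : ∀ {n} (c : Necklace n) i k → Dec (Gap c i k)
gap? c i k = all? (λ j → lookup c (i ↻ suc (toℕ j)) ≟ white)
       ×-dec (lookup c (i ↻ suc k) ≟ black)

admissible? : ∀ q {n} (c : Necklace n) → Dec (Admissible q c)
admissible? q c =
        any? (λ i → lookup c i ≟ black)
  ×-dec all? (λ i → (lookup c i ≟ black) →-dec
        all? (λ k → gap? c i (toℕ k) →-dec (q ∣? toℕ k)))

necklaces : ∀ n → List (Necklace n)
necklaces zero    = [] ∷ []
necklaces (suc n) = map (black ∷_) (necklaces n) ++ map (white ∷_) (necklaces n)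

a : ℕ → ℕ → ℕ
a q n = length (filter (admissible? q) (necklaces n))

L : ℕ → ℕ
L 0             = 2
L 1             = 1
L (suc (suc n)) = L (suc n) + L n

infix 4 _≡_[mod_]
_≡_[mod_] : ℕ → ℕ → ℕ → Set
x ≡ y [mod n ] = (ℤ.+ n) ℤ.∣ (ℤ.+ x ℤ.- ℤ.+ y)

{-# OPTIONS --safe #-}
-- Let g be a rotation-invariant weight on the necklaces with n beads, vanishing
-- on the all-white one and equal to 1 on the all-black one, and write |c| for
-- the number of black beads of c.  By rotation invariance, the sum of g c over
-- the necklaces c with a black bead at a given position does not depend on the
-- position, so n divides Σ g c · |c|; replacing g c by g c · (n-1)!/|c| shows
-- that n divides (n-1)! · Σ g c, the sum being over non-constant c.  For n prime
-- the factor (n-1)! cancels, so Σ g c ≡ 1.  This applies to the indicator of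
-- admissibility, and to the indicator of "no two cyclically adjacent white
-- beads", whose sum is the Lucas number.
module Submission where

open import Defs
open import Algebra.Properties.CommutativeSemigroup using (interchange; xy∙z≈xz∙y; x∙yz≈y∙xz)
open import Data.Bool.Base using (Bool; true; false; if_then_else_)
open import Data.Fin.Base using (Fin; zero; suc; toℕ; inject₁; fromℕ)
open import Data.Fin.Properties using (toℕ-injective; toℕ-fromℕ<; toℕ-inject₁; toℕ-fromℕ; toℕ<n)
open import Data.Fin.Relation.Unary.Top using (view; ‵fromℕ; ‵inject₁)
open import Data.List.Base as List using (List; []; _∷_; [_]; map; filter; length)
import Data.List.Properties as List
open import Data.Nat.Base using (ℕ; zero; suc; _+_; _*_; _/_; _%_; _!; _≤_; _<_; _≥_;
  z≤n; s≤s; z<s; s<s; nonTrivial⇒n>1)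
open import Data.Nat.Properties hiding (_≟_)
open import Data.Nat.Divisibility
open import Data.Nat.DivMod using (m*[n/m]≡n; m<n⇒m%n≡m; m%n<n; n%n≡0;
  %-distribˡ-+; m%n%n≡m%n; [m+n]%n≡m%n)
open import Data.Nat.ListAction using (sum)
open import Data.Nat.ListAction.Properties using (sum-++)
open import Data.Nat.Primality using (Prime; euclidsLemma; prime⇒nonTrivial)
open import Data.Product.Base using (_×_; _,_)
open import Data.Sum.Base using (inj₁; inj₂)
open import Data.Vec.Base using ([]; _∷_; _∷ʳ_; lookup; replicate; toList)
open import Data.Vec.Properties using (toList-∷ʳ; length-toList; lookup-replicate; ∷-injectiveʳ; ≡-dec)
open import Function.Base using (_∘_)
open import Function.Bundles using (mk⇔)
open import Relation.Binary.PropositionalEquality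
  using (_≡_; _≢_; _≗_; refl; sym; trans; cong; cong₂; subst; module ≡-Reasoning)
open import Relation.Nullary.Decidable using (yes; no; does; does-⇔; dec-true; dec-false)
open import Relation.Nullary.Negation using (¬_; contradiction)
open import Relation.Unary using (Decidable)

open ≡-Reasoning

private variable
  n : ℕ

-- Sums over all necklaces and their invariance under rotation.

rotate : Necklace (suc n) → Necklace (suc n)
rotate (x ∷ c) = c ∷ʳ x

total : (Necklace n → ℕ) → ℕ
total {n} f = sum (map f (necklaces n))

total-suc : (f : Necklace (suc n) → ℕ) →
            total f ≡ total (f ∘ (black ∷_)) + total (f ∘ (white ∷_))
total-suc {n} f = begin
  sum (map f (map (black ∷_) N List.++ map (white ∷_) N))
    ≡⟨ cong sum (List.map-++ f (map (black ∷_) N) (map (white ∷_) N)) ⟩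
  sum (map f (map (black ∷_) N) List.++ map f (map (white ∷_) N))
    ≡⟨ sum-++ (map f (map (black ∷_) N)) _ ⟩
  sum (map f (map (black ∷_) N)) + sum (map f (map (white ∷_) N))
    ≡⟨ cong₂ (λ xs ys → sum xs + sum ys) (List.map-∘ N) (List.map-∘ N) ⟨
  total (f ∘ (black ∷_)) + total (f ∘ (white ∷_)) ∎
  where N = necklaces n

total-cong : {f g : Necklace n → ℕ} → f ≗ g → total f ≡ total g
total-cong f≗g = cong sum (List.map-cong f≗g (necklaces _))

total-+ : (f g : Necklace n → ℕ) → total (λ c → f c + g c) ≡ total f + total g
total-+ {n} f g = go (necklaces n)
  where
  go : ∀ cs → sum (map (λ c → f c + g c) cs) ≡ sum (map f cs) + sum (map g cs)
  go []       = refl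
  go (c ∷ cs) = trans (cong (f c + g c +_) (go cs))
    (interchange +-commutativeSemigroup (f c) (g c) (sum (map f cs)) (sum (map g cs)))

total-*ˡ : ∀ k (f : Necklace n → ℕ) → total (λ c → k * f c) ≡ k * total f
total-*ˡ {n} k f = go (necklaces n)
  where
  go : ∀ cs → sum (map (λ c → k * f c) cs) ≡ k * sum (map f cs)
  go []       = sym (*-zeroʳ k)
  go (c ∷ cs) = trans (cong (k * f c +_) (go cs)) (sym (*-distribˡ-+ k (f c) _))

total-0 : total {n} (λ _ → 0) ≡ 0
total-0 {n} = total-*ˡ {n} 0 (λ _ → 0)

-- Induction on the length: splitting off the first bead and then the last gives four sums, which
-- are regrouped by the last bead. For a single bead, first and last coincide.
total-∷ʳ : (f : Necklace (suc n) → ℕ) →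
           total f ≡ total (f ∘ (_∷ʳ black)) + total (f ∘ (_∷ʳ white))
total-∷ʳ {zero}  f = total-suc f
total-∷ʳ {suc n} f = begin
  total f
    ≡⟨ total-suc f ⟩
  total (f ∘ (black ∷_)) + total (f ∘ (white ∷_))
    ≡⟨ cong₂ _+_ (total-∷ʳ (f ∘ (black ∷_))) (total-∷ʳ (f ∘ (white ∷_))) ⟩
  (t black black + t black white) + (t white black + t white white)
    ≡⟨ interchange +-commutativeSemigroup (t black black) _ _ _ ⟩
  (t black black + t white black) + (t black white + t white white)
    ≡⟨ cong₂ _+_ (total-suc (f ∘ (_∷ʳ black))) (total-suc (f ∘ (_∷ʳ white))) ⟨
  total (f ∘ (_∷ʳ black)) + total (f ∘ (_∷ʳ white)) ∎
  where
  t : Color → Color → ℕ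
  t x y = total (λ c → f (x ∷ (c ∷ʳ y)))

-- Splitting by the first bead before rotating matches splitting by the last bead afterwards, so no
-- permutation of the list `necklaces` has to be exhibited.
total-rotate : (f : Necklace (suc n) → ℕ) → total (f ∘ rotate) ≡ total f
total-rotate f = trans (total-suc (f ∘ rotate)) (sym (total-∷ʳ f))

-- Both sides are `f v + g v` plus the common sum away from `v`. The additive form avoids
-- subtraction in `ℕ`.
total-differ-at : (v : Necklace n) (f g : Necklace n → ℕ) →
                  (∀ c → c ≢ v → f c ≡ g c) → total f + g v ≡ f v + total g
total-differ-at []          f g eq = trans (+-assoc (f []) 0 (g []))
  (cong (f [] +_) (+-comm 0 (g [])))
total-differ-at (black ∷ v) f g eq = begin
  total f + g (black ∷ v)
    ≡⟨ cong (_+ g (black ∷ v)) (total-suc f) ⟩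
  total f₁ + total f₀ + g (black ∷ v)
    ≡⟨ cong (λ t → total f₁ + t + g (black ∷ v)) (total-cong λ c → eq (white ∷ c) λ ()) ⟩
  total f₁ + total g₀ + g (black ∷ v)
    ≡⟨ xy∙z≈xz∙y +-commutativeSemigroup (total f₁) (total g₀) _ ⟩
  total f₁ + g (black ∷ v) + total g₀
    ≡⟨ cong (_+ total g₀) (total-differ-at v f₁ g₁ λ c c≢v → eq (black ∷ c) (c≢v ∘ ∷-injectiveʳ)) ⟩
  f (black ∷ v) + total g₁ + total g₀
    ≡⟨ +-assoc (f (black ∷ v)) _ _ ⟩
  f (black ∷ v) + (total g₁ + total g₀)
    ≡⟨ cong (f (black ∷ v) +_) (total-suc g) ⟨
  f (black ∷ v) + total g ∎
  where
  f₁ = f ∘ (black ∷_)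
  f₀ = f ∘ (white ∷_)
  g₁ = g ∘ (black ∷_)
  g₀ = g ∘ (white ∷_)
total-differ-at (white ∷ v) f g eq = begin
  total f + g (white ∷ v)
    ≡⟨ cong (_+ g (white ∷ v)) (total-suc f) ⟩
  total f₁ + total f₀ + g (white ∷ v)
    ≡⟨ cong (λ t → t + total f₀ + g (white ∷ v)) (total-cong λ c → eq (black ∷ c) λ ()) ⟩
  total g₁ + total f₀ + g (white ∷ v)
    ≡⟨ +-assoc (total g₁) _ _ ⟩
  total g₁ + (total f₀ + g (white ∷ v))
    ≡⟨ cong (total g₁ +_) (total-differ-at v f₀ g₀ λ c c≢v → eq (white ∷ c) (c≢v ∘ ∷-injectiveʳ)) ⟩
  total g₁ + (f (white ∷ v) + total g₀)
    ≡⟨ x∙yz≈y∙xz +-commutativeSemigroup (total g₁) (f (white ∷ v)) (total g₀) ⟩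
  f (white ∷ v) + (total g₁ + total g₀)
    ≡⟨ cong (f (white ∷ v) +_) (total-suc g) ⟨
  f (white ∷ v) + total g ∎
  where
  f₁ = f ∘ (black ∷_)
  f₀ = f ∘ (white ∷_)
  g₁ = g ∘ (black ∷_)
  g₀ = g ∘ (white ∷_)

-- Double counting of black beads.

isBlack : Color → ℕ
isBlack black = 1
isBlack white = 0

blacks : List Color → ℕ
blacks xs = sum (map isBlack xs)

blacksIn : Necklace n → ℕ
blacksIn c = blacks (toList c)

blacks-++ : ∀ xs ys → blacks (xs List.++ ys) ≡ blacks xs + blacks ys
blacks-++ xs ys = trans (cong sum (List.map-++ isBlack xs ys)) (sum-++ (map isBlack xs) _)

blacksIn-rotate : (c : Necklace (suc n)) → blacksIn (rotate c) ≡ blacksIn c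
blacksIn-rotate (x ∷ c) = begin
  blacks (toList (c ∷ʳ x))          ≡⟨ cong blacks (toList-∷ʳ x c) ⟩
  blacks (toList c List.++ [ x ])   ≡⟨ blacks-++ (toList c) [ x ] ⟩
  blacksIn c + (isBlack x + 0)      ≡⟨ +-comm (blacksIn c) _ ⟩
  isBlack x + 0 + blacksIn c        ≡⟨ cong (_+ blacksIn c) (+-identityʳ _) ⟩
  isBlack x + blacksIn c            ∎

blacksIn≤n : (c : Necklace n) → blacksIn c ≤ n
blacksIn≤n []          = z≤n
blacksIn≤n (black ∷ c) = s≤s (blacksIn≤n c)
blacksIn≤n (white ∷ c) = m≤n⇒m≤1+n (blacksIn≤n c)

blacksIn<n : (c : Necklace n) → c ≢ replicate n black → blacksIn c < n
blacksIn<n []          c≢B = contradiction refl c≢B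
blacksIn<n (black ∷ c) c≢B = s<s (blacksIn<n c (c≢B ∘ cong (black ∷_)))
blacksIn<n (white ∷ c) c≢B = s≤s (blacksIn≤n c)

blacksIn>0 : (c : Necklace n) → c ≢ replicate n white → 0 < blacksIn c
blacksIn>0 []          c≢W = contradiction refl c≢W
blacksIn>0 (black ∷ c) c≢W = z<s
blacksIn>0 (white ∷ c) c≢W = blacksIn>0 c (c≢W ∘ cong (white ∷_))

headBlack : Necklace (suc n) → ℕ
headBlack (x ∷ _) = isBlack x

-- Beads are inspected by rotating them to the head, so that a sum over positions becomes a sum over
-- rotations, to which `total-rotate` applies.
headBlacks : ℕ → Necklace (suc n) → ℕ
headBlacks zero    c = 0
headBlacks (suc k) c = headBlack c + headBlacks k (rotate c)

-- The suffix `ys` is there for the induction: each rotation removes the head of `xs` and appends it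
-- to `ys`.
headBlacks-prefix : ∀ xs ys (c : Necklace (suc n)) → toList c ≡ xs List.++ ys →
                    headBlacks (length xs) c ≡ blacks xs
headBlacks-prefix []       ys c       eq = refl
headBlacks-prefix (x ∷ xs) ys (y ∷ c) eq = cong₂ _+_ (cong isBlack (List.∷-injectiveˡ eq))
  (headBlacks-prefix xs (ys List.++ [ y ]) (c ∷ʳ y) (begin
    toList (c ∷ʳ y)               ≡⟨ toList-∷ʳ y c ⟩
    toList c List.++ [ y ]        ≡⟨ cong (List._++ [ y ]) (List.∷-injectiveʳ eq) ⟩
    (xs List.++ ys) List.++ [ y ] ≡⟨ List.++-assoc xs ys [ y ] ⟩
    xs List.++ (ys List.++ [ y ]) ∎))

headBlacks-all : (c : Necklace (suc n)) → headBlacks (suc n) c ≡ blacksIn c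
headBlacks-all c = trans (cong (λ k → headBlacks k c) (sym (length-toList c)))
  (headBlacks-prefix (toList c) [] c (sym (List.++-identityʳ _)))

-- Replacing `g c` by `g (rotate c)` makes all but the first summand a function of `rotate c`;
-- `total-rotate` then removes the rotation, so each of the `k` inspections contributes the same
-- amount.
total-headBlacks : ∀ k (g : Necklace (suc n) → ℕ) → (∀ c → g (rotate c) ≡ g c) →
  total (λ c → g c * headBlacks k c) ≡ k * total (λ c → g c * headBlack c)
total-headBlacks {n} zero g inv = trans (total-cong (λ c → *-zeroʳ (g c))) (total-0 {suc n})
total-headBlacks (suc k) g inv = begin
  total (λ c → g c * (headBlack c + headBlacks k (rotate c)))
    ≡⟨ total-cong (λ c → trans (*-distribˡ-+ (g c) (headBlack c) _)
         (cong (λ z → g c * headBlack c + z * headBlacks k (rotate c)) (sym (inv c)))) ⟩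
  total (λ c → g c * headBlack c + g (rotate c) * headBlacks k (rotate c))
    ≡⟨ total-+ (λ c → g c * headBlack c) _ ⟩
  total (λ c → g c * headBlack c) + total ((λ c → g c * headBlacks k c) ∘ rotate)
    ≡⟨ cong (total (λ c → g c * headBlack c) +_)
         (trans (total-rotate (λ c → g c * headBlacks k c)) (total-headBlacks k g inv)) ⟩
  suc k * total (λ c → g c * headBlack c) ∎

n∣total-blacksIn : (g : Necklace (suc n) → ℕ) → (∀ c → g (rotate c) ≡ g c) →
                   suc n ∣ total (λ c → g c * blacksIn c)
n∣total-blacksIn {n} g inv = subst (suc n ∣_)
  (trans (sym (total-headBlacks (suc n) g inv))
         (total-cong (λ c → cong (g c *_) (headBlacks-all c))))
  (m∣m*n _)

-- The congruence modulo a prime for rotation-invariant weights.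

prime∤! : ∀ {p} → Prime p → ∀ k → k < p → ¬ p ∣ k !
prime∤! pp zero    _   p∣1 = >⇒∤ (nonTrivial⇒n>1 _ {{prime⇒nonTrivial pp}}) p∣1
prime∤! pp (suc k) k<p p∣k! with euclidsLemma (suc k) (k !) pp p∣k!
... | inj₁ p∣1+k = >⇒∤ k<p p∣1+k
... | inj₂ p∣k!′ = prime∤! pp k (<-trans (n<1+n k) k<p) p∣k!′

-- The value at `zero` is a default: it is reached only at the all-white necklace, where the weight
-- vanishes.
cofactor : ℕ → ℕ → ℕ
cofactor n zero    = 0
cofactor n (suc k) = n ! / suc k

-- The division is exact because `k` divides `k !`, which divides `n !`.
cofactor-* : ∀ {n k} → 0 < k → k ≤ n → cofactor n k * k ≡ n !
cofactor-* {n} {suc k} _ k≤n = trans (*-comm (n ! / suc k) (suc k))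
  (m*[n/m]≡n (∣-trans (m∣m*n (k !)) (m≤n⇒m!∣n! k≤n)))

module _ (g : Necklace (suc n) → ℕ)
         (inv : ∀ c → g (rotate c) ≡ g c)
         (gW≡0 : g (replicate _ white) ≡ 0)
         (gB≡1 : g (replicate _ black) ≡ 1)
         where

  private
    B = replicate (suc n) black

    h : Necklace (suc n) → ℕ
    h c = g c * cofactor n (blacksIn c)

    h-rotate : ∀ c → h (rotate c) ≡ h c
    h-rotate c = cong₂ (λ x y → x * cofactor n y) (inv c) (blacksIn-rotate c)

    -- At the all-white necklace both sides vanish; any other `c` has between 1 and `n` black beads,
    -- so the cofactor is exact. At `B` there are `suc n` black beads and the quotient may be
    -- rounded, hence the exclusion.
    agree : ∀ c → c ≢ B → n ! * g c ≡ h c * blacksIn c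
    agree c c≢B with ≡-dec _≟_ c (replicate _ white)
    ... | yes refl rewrite gW≡0 = *-zeroʳ (n !)
    ... | no  c≢W = begin
      n ! * g c
        ≡⟨ cong (_* g c) (cofactor-* (blacksIn>0 c c≢W) (≤-pred (blacksIn<n c c≢B))) ⟨
      cofactor n (blacksIn c) * blacksIn c * g c
        ≡⟨ *-comm _ (g c) ⟩
      g c * (cofactor n (blacksIn c) * blacksIn c)
        ≡⟨ *-assoc (g c) _ _ ⟨
      h c * blacksIn c ∎

    blacksIn-B : ∀ n → blacksIn (replicate n black) ≡ n
    blacksIn-B zero    = refl
    blacksIn-B (suc n) = cong suc (blacksIn-B n)

    R = total (λ c → h c * blacksIn c)

    n∣R : suc n ∣ R
    n∣R = n∣total-blacksIn h h-rotate

    -- The possibly rounded value `h B` enters only through a multiple of `suc n`, and `R` is such a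
    -- multiple too, so modulo `suc n` this reads `n ! * total g` congruent to `n !`.
    balance : n ! * total g + h B * suc n ≡ n ! + R
    balance = begin
      n ! * total g + h B * suc n
        ≡⟨ cong₂ (λ x y → x + h B * y) (total-*ˡ (n !) g) (blacksIn-B (suc n)) ⟨
      total (λ c → n ! * g c) + h B * blacksIn B
        ≡⟨ total-differ-at B (λ c → n ! * g c) (λ c → h c * blacksIn c) agree ⟩
      n ! * g B + R
        ≡⟨ cong (_+ R) (trans (cong (n ! *_) gB≡1) (*-identityʳ (n !))) ⟩
      n ! + R ∎

  total≡1 : Prime (suc n) → total g ≡ 1 [mod suc n ]
  total≡1 pp with total g | balance
  -- A zero sum is impossible: `balance` would make `suc n` divide `n !`.
  ... | zero  | eq = contradiction (∣m+n∣m⇒∣n n∣R+n! n∣R) (prime∤! pp n ≤-refl)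
    where
    n∣R+n! : suc n ∣ R + n !
    n∣R+n! = subst (suc n ∣_) (begin
      h B * suc n           ≡⟨ cong (_+ h B * suc n) (*-zeroʳ (n !)) ⟨
      n ! * 0 + h B * suc n ≡⟨ eq ⟩
      n ! + R               ≡⟨ +-comm (n !) R ⟩
      R + n !               ∎) (n∣m*n (h B))
  -- The integer difference from 1 now reduces to `t`. Cancelling one `n !` in `balance` shows that
  -- `suc n` divides `n ! * t`.
  ... | suc t | eq with euclidsLemma (n !) t pp (∣m+n∣m⇒∣n n∣sum (n∣m*n (h B)))
    where
    n∣sum : suc n ∣ h B * suc n + n ! * t
    n∣sum = subst (suc n ∣_) (+-cancelˡ-≡ (n !) _ _ (begin
      n ! + R                         ≡⟨ eq ⟨
      n ! * suc t + h B * suc n       ≡⟨ cong (_+ h B * suc n) (*-suc (n !) t) ⟩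
      n ! + n ! * t + h B * suc n     ≡⟨ +-assoc (n !) _ _ ⟩
      n ! + (n ! * t + h B * suc n)   ≡⟨ cong (n ! +_) (+-comm (n ! * t) _) ⟩
      n ! + (h B * suc n + n ! * t)   ∎)) n∣R
  ...   | inj₁ p∣n! = contradiction p∣n! (prime∤! pp n ≤-refl)
  ...   | inj₂ p∣t  = p∣t

-- Admissibility as a rotation-invariant weight.

indicator : Bool → ℕ
indicator b = if b then 1 else 0

length-filter-necklaces : ∀ {P : Necklace n → Set} (P? : Decidable P) →
  length (filter P? (necklaces n)) ≡ total (indicator ∘ does ∘ P?)
length-filter-necklaces {n} P? = go (necklaces n)
  where
  go : ∀ cs → length (filter P? cs) ≡ sum (map (indicator ∘ does ∘ P?) cs)
  go []       = refl
  go (c ∷ cs) with does (P? c)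
  ... | true  = cong suc (go cs)
  ... | false = go cs

toℕ-↻ : ∀ (i : Fin (suc n)) k → toℕ (i ↻ k) ≡ (toℕ i + k) % suc n
toℕ-↻ {n} i k = toℕ-fromℕ< (m%n<n (toℕ i + k) (suc n))

↻-+ : ∀ (i : Fin (suc n)) k l → i ↻ k ↻ l ≡ i ↻ (k + l)
↻-+ {n} i k l = toℕ-injective (begin
  toℕ (i ↻ k ↻ l)                 ≡⟨ toℕ-↻ (i ↻ k) l ⟩
  (toℕ (i ↻ k) + l) % N           ≡⟨ cong (λ z → (z + l) % N) (toℕ-↻ i k) ⟩
  ((toℕ i + k) % N + l) % N       ≡⟨ %-distribˡ-+ ((toℕ i + k) % N) l N ⟩
  ((toℕ i + k) % N % N + l % N) % N ≡⟨ cong (λ z → (z + l % N) % N) (m%n%n≡m%n (toℕ i + k) N) ⟩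
  ((toℕ i + k) % N + l % N) % N   ≡⟨ %-distribˡ-+ (toℕ i + k) l N ⟨
  (toℕ i + k + l) % N             ≡⟨ cong (_% N) (+-assoc (toℕ i) k l) ⟩
  (toℕ i + (k + l)) % N           ≡⟨ toℕ-↻ i (k + l) ⟨
  toℕ (i ↻ (k + l))               ∎)
  where N = suc n

↻-comm : ∀ (i : Fin (suc n)) k l → i ↻ k ↻ l ≡ i ↻ l ↻ k
↻-comm i k l = trans (↻-+ i k l) (trans (cong (i ↻_) (+-comm k l)) (sym (↻-+ i l k)))

↻-n : ∀ (i : Fin (suc n)) → i ↻ suc n ≡ i
↻-n {n} i = toℕ-injective (trans (toℕ-↻ i (suc n))
  (trans ([m+n]%n≡m%n (toℕ i) (suc n)) (m<n⇒m%n≡m (toℕ<n i))))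

-- Among `suc n` positions, `n` steps clockwise are one step back; this inverts `_↻ 1`.
↻-pred : ∀ (i : Fin (suc n)) → i ↻ n ↻ 1 ≡ i
↻-pred {n} i = trans (↻-+ i n 1) (trans (cong (i ↻_) (+-comm n 1)) (↻-n i))

inject₁↻1 : (j : Fin n) → inject₁ j ↻ 1 ≡ suc j
inject₁↻1 {n} j = toℕ-injective (begin
  toℕ (inject₁ j ↻ 1)           ≡⟨ toℕ-↻ (inject₁ j) 1 ⟩
  (toℕ (inject₁ j) + 1) % suc n ≡⟨ cong (λ k → (k + 1) % suc n) (toℕ-inject₁ j) ⟩
  (toℕ j + 1) % suc n           ≡⟨ cong (_% suc n) (+-comm (toℕ j) 1) ⟩
  suc (toℕ j) % suc n           ≡⟨ m<n⇒m%n≡m (s<s (toℕ<n j)) ⟩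
  suc (toℕ j)                   ∎)

fromℕ↻1 : ∀ n → fromℕ n ↻ 1 ≡ zero
fromℕ↻1 n = toℕ-injective (begin
  toℕ (fromℕ n ↻ 1)           ≡⟨ toℕ-↻ (fromℕ n) 1 ⟩
  (toℕ (fromℕ n) + 1) % suc n ≡⟨ cong (_% suc n) (trans (cong (_+ 1) (toℕ-fromℕ n)) (+-comm n 1)) ⟩
  suc n % suc n               ≡⟨ n%n≡0 (suc n) ⟩
  0                           ∎)

lookup-∷ʳ-inject₁ : ∀ (c : Necklace n) x i → lookup (c ∷ʳ x) (inject₁ i) ≡ lookup c i
lookup-∷ʳ-inject₁ (y ∷ c) x zero    = refl
lookup-∷ʳ-inject₁ (y ∷ c) x (suc i) = lookup-∷ʳ-inject₁ c x i

lookup-∷ʳ-fromℕ : ∀ (c : Necklace n) x → lookup (c ∷ʳ x) (fromℕ n) ≡ x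
lookup-∷ʳ-fromℕ []      x = refl
lookup-∷ʳ-fromℕ (y ∷ c) x = lookup-∷ʳ-fromℕ c x

-- The last position holds the old head and wraps round to `zero`; any other position is some
-- `inject₁ j` and reads the old bead at `suc j`.
lookup-rotate : ∀ (c : Necklace (suc n)) i → lookup (rotate c) i ≡ lookup c (i ↻ 1)
lookup-rotate {n} (x ∷ c) i with view i
... | ‵fromℕ     = trans (lookup-∷ʳ-fromℕ c x) (cong (lookup (x ∷ c)) (sym (fromℕ↻1 n)))
... | ‵inject₁ j = trans (lookup-∷ʳ-inject₁ c x j) (cong (lookup (x ∷ c)) (sym (inject₁↻1 j)))

lookup-rotate-↻ : ∀ (c : Necklace (suc n)) i k →
                  lookup (rotate c) (i ↻ k) ≡ lookup c (i ↻ 1 ↻ k)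
lookup-rotate-↻ c i k = trans (lookup-rotate c (i ↻ k)) (cong (lookup c) (↻-comm i k 1))

gap-rotate⁺ : ∀ (c : Necklace (suc n)) i k → Gap c (i ↻ 1) k → Gap (rotate c) i k
gap-rotate⁺ c i k (ws , b) =
  (λ j → trans (lookup-rotate-↻ c i _) (ws j)) , trans (lookup-rotate-↻ c i _) b

gap-rotate⁻ : ∀ (c : Necklace (suc n)) i k → Gap (rotate c) i k → Gap c (i ↻ 1) k
gap-rotate⁻ c i k (ws , b) =
  (λ j → trans (sym (lookup-rotate-↻ c i _)) (ws j)) , trans (sym (lookup-rotate-↻ c i _)) b

-- Position `j` of `rotate c` is position `j ↻ 1` of `c`: the black witness moves one step back,
-- while gaps of `rotate c` are read in `c` one step ahead.
admissible-rotate⁺ : ∀ q (c : Necklace (suc n)) → Admissible q c → Admissible q (rotate c)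
admissible-rotate⁺ {n} q c ((i , b) , gaps) =
  (i ↻ n , trans (lookup-rotate c _) (trans (cong (lookup c) (↻-pred i)) b)) ,
  λ j bj k gap → gaps (j ↻ 1) (trans (sym (lookup-rotate c j)) bj) k (gap-rotate⁻ c j _ gap)

admissible-rotate⁻ : ∀ q (c : Necklace (suc n)) → Admissible q (rotate c) → Admissible q c
admissible-rotate⁻ {n} q c ((i , b) , gaps) =
  (i ↻ 1 , trans (sym (lookup-rotate c i)) b) ,
  λ j bj k gap → gaps (j ↻ n)
    (trans (lookup-rotate c _) (trans (cong (lookup c) (↻-pred j)) bj)) k
    (gap-rotate⁺ c (j ↻ n) _ (subst (λ i → Gap c i (toℕ k)) (sym (↻-pred j)) gap))

black≢white : black ≢ white
black≢white ()

admissible-black : ∀ q n → Admissible q (replicate (suc n) black)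
admissible-black q n = (zero , refl) , λ i _ k → gap⇒∣ i (toℕ k)
  where
  gap⇒∣ : ∀ i k → Gap (replicate (suc n) black) i k → q ∣ k
  gap⇒∣ i zero    _        = q ∣0
  -- A positive gap would need a white bead right after `i`, so only the gap 0 occurs.
  gap⇒∣ i (suc k) (ws , _) = contradiction
    (trans (sym (lookup-replicate (i ↻ 1) black)) (ws zero)) black≢white

¬admissible-white : ∀ q n → ¬ Admissible q (replicate n white)
¬admissible-white q n ((i , b) , _) = black≢white (trans (sym b) (lookup-replicate i white))

a≡1 : ∀ q n → Prime n → a q n ≡ 1 [mod n ]
a≡1 q zero    ()
a≡1 q (suc n) pp = subst (_≡ 1 [mod suc n ]) (sym (length-filter-necklaces {suc n} (admissible? q)))
  (total≡1 (indicator ∘ does ∘ admissible? q)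
    (λ c → cong indicator (does-⇔ (mk⇔ (admissible-rotate⁻ q c) (admissible-rotate⁺ q c))
      (admissible? q (rotate c)) (admissible? q c)))
    (cong indicator (dec-false (admissible? q (replicate (suc n) white))
      (¬admissible-white q (suc n))))
    (cong indicator (dec-true (admissible? q (replicate (suc n) black))
      (admissible-black q n)))
    pp)

-- Lucas numbers as counts of cyclic colourings without adjacent white beads.

notBothWhite : Color → Color → ℕ
notBothWhite white white = 0
notBothWhite _     _     = 1

-- The number (0 or 1) of ways in which the beads c may be placed between beads
-- coloured x and y without making two white beads adjacent.
path : Color → Necklace n → Color → ℕ
path x []      y = notBothWhite x y
path x (z ∷ c) y = notBothWhite x z * path z c y

-- The head closes the path at both ends. A single bead is thus its own neighbour, and a lone white
-- bead counts 0, in agreement with `L 1`.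
cycle : Necklace (suc n) → ℕ
cycle (x ∷ c) = path x c x

path-∷ʳ : ∀ x (c : Necklace n) y z → path x (c ∷ʳ y) z ≡ path x c y * notBothWhite y z
path-∷ʳ x []      y z = refl
path-∷ʳ x (w ∷ c) y z = trans (cong (notBothWhite x w *_) (path-∷ʳ w c y z))
  (sym (*-assoc (notBothWhite x w) _ _))

-- Rotation only moves the factor of the first two beads from the front of the product to its end.
cycle-rotate : (c : Necklace (suc n)) → cycle (rotate c) ≡ cycle c
cycle-rotate (x ∷ [])    = refl
cycle-rotate (x ∷ y ∷ c) = trans (path-∷ʳ y c x y) (*-comm (path y c x) _)

-- The (x, y) entry of the power M^(n+1) of the transfer matrix M with entries `notBothWhite`;
-- `total-cycle` expresses the sum of `cycle` as the trace of that power.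
paths : Color → ℕ → Color → ℕ
paths x n y = total {n} λ c → path x c y

paths-suc : ∀ x n y → paths x (suc n) y ≡
            notBothWhite x black * paths black n y + notBothWhite x white * paths white n y
paths-suc x n y = trans (total-suc {n} (λ c → path x c y))
  (cong₂ _+_ (total-*ˡ {n} (notBothWhite x black) (λ c → path black c y))
             (total-*ˡ {n} (notBothWhite x white) (λ c → path white c y)))

paths-white : ∀ n y → paths white (suc n) y ≡ paths black n y
paths-white n y = trans (paths-suc white n y)
  (trans (+-identityʳ (1 * paths black n y)) (*-identityˡ _))

paths-black : ∀ n y → paths black (suc n) y ≡ paths black n y + paths white n y
paths-black n y = trans (paths-suc black n y)
  (cong₂ _+_ (*-identityˡ (paths black n y)) (*-identityˡ (paths white n y)))

total-cycle : ∀ n → total {suc n} cycle ≡ paths black n black + paths white n white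
total-cycle n = total-suc {n} cycle

-- In matrix terms, M^2 = M + 1 multiplied by M^(n+1).
paths-fib : ∀ x n y → paths x (2 + n) y ≡ paths x (1 + n) y + paths x n y
paths-fib black n y = trans (paths-black (suc n) y)
  (cong (paths black (suc n) y +_) (paths-white n y))
paths-fib white n y = begin
  paths white (2 + n) y                   ≡⟨ paths-white (suc n) y ⟩
  paths black (1 + n) y                   ≡⟨ paths-black n y ⟩
  paths black n y + paths white n y       ≡⟨ cong (_+ paths white n y) (paths-white n y) ⟨
  paths white (1 + n) y + paths white n y ∎

total-cycle≡L : ∀ n → total {suc n} cycle ≡ L (suc n)
-- The recursion starts from one and two beads, with sums 1 and 3; `cycle` needs a head bead, so the
-- index is shifted past `L 0`.
total-cycle≡L 0 = refl
total-cycle≡L 1 = refl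
total-cycle≡L (suc (suc n)) = begin
  total {3 + n} cycle
    ≡⟨ total-cycle (2 + n) ⟩
  paths black (2 + n) black + paths white (2 + n) white
    ≡⟨ cong₂ _+_ (paths-fib black n black) (paths-fib white n white) ⟩
  (paths black (1 + n) black + paths black n black) + (paths white (1 + n) white + paths white n white)
    ≡⟨ interchange +-commutativeSemigroup (paths black (1 + n) black) _ _ _ ⟩
  (paths black (1 + n) black + paths white (1 + n) white) + (paths black n black + paths white n white)
    ≡⟨ cong₂ _+_ (trans (sym (total-cycle (1 + n))) (total-cycle≡L (suc n)))
                 (trans (sym (total-cycle n)) (total-cycle≡L n)) ⟩
  L (3 + n) ∎

cycle-black : ∀ n → cycle (replicate (suc n) black) ≡ 1
cycle-black zero    = refl
cycle-black (suc n) = trans (*-identityˡ _) (cycle-black n)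

cycle-white : ∀ n → cycle (replicate (suc n) white) ≡ 0
cycle-white zero    = refl
cycle-white (suc n) = refl

L≡1 : ∀ n → Prime n → L n ≡ 1 [mod n ]
L≡1 zero    ()
L≡1 (suc n) pp = subst (_≡ 1 [mod suc n ]) (total-cycle≡L n)
  (total≡1 cycle cycle-rotate (cycle-white n) (cycle-black n) pp)

corollary1 : (∀ (q : ℕ) → q ≥ 1 → ∀ (n : ℕ) → Prime n → a q n ≡ 1 [mod n ])
    × (∀ (n : ℕ) → Prime n → L n ≡ 1 [mod n ])
corollary1 = (λ q _ → a≡1 q) , L≡1
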